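{- Let $1\le\ell\le m$ be integers, let $k=\binom{m}{\ell}$ and $\mu:=\max\{\ell,m-\ell\}+1$. Given $\Lambda\subseteq I_\ell[m]$, we have $$K_\Lambda\le(\ell-1)\binom{|\Lambda|}{2}.$$ Moreover, equality holds if and only if $\Lambda$ is a close family. Consequently, for any nonnegative integer $r\le k$, we have $$K_r(\ell,m)\le(\ell-1)\binom{r}{2}.$$ Moreover, equality holds in this last inequality if and only if $r\le\mu$.
   Context: $[m]:=\{1,\dots,m\}$, and $I_\ell[m]$ denotes the set of all subsets of $[m]$ of cardinality $\ell$. A family $\Lambda\subseteq I_\ell[m]$ is called close if $|A\cap B|=\ell-1$ for all distinct $A,B\in\Lambda$. For $\Lambda=\{A_1,\dots,A_r\}\subseteq I_\ell[m]$ with $|\Lambda|=r$ (the $A_i$ distinct), put $K_\Lambda:=\sum_{1\le i<j\le r}|A_i\cap A_j|$. For an integer $0\le r\le k$, put $K_r(\ell,m):=\max\{K_\Lambda : \Lambda\subseteq I_\ell[m],\ |\Lambda|=r\}$. -}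

module Defs where

import Data.Bool.Properties as Bool
open import Data.Fin.Subset using (Subset; _∩_; ∣_∣; inside; outside)
open import Data.List.Base using (List; []; _∷_; length; map; filter; cartesianProductWith)
open import Data.List.Extrema.Nat using (max; argmax-sel; xs≤max)
open import Data.List.Membership.Propositional using (_∈_)
open import Data.List.Membership.Propositional.Properties
  using (∈-cartesianProductWith⁺; ∈-cartesianProductWith⁻; ∈-filter⁺; ∈-filter⁻; ∈-map⁺; ∈-map⁻)
open import Data.List.Relation.Unary.All as All using (All)
open import Data.List.Relation.Unary.Any using (here; there)
import Data.List.Relation.Unary.Unique.DecPropositional as DecUnique
open import Data.List.Relation.Unary.Unique.Propositional using (Unique)
open import Data.Nat.Base using (ℕ; zero; suc; _+_; _∸_; _≤_; _⊔_; z≤n)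
open import Data.Nat.ListAction using (sum)
open import Data.Nat.Properties using (_≟_; ≤-antisym; ≤-trans; ≤-reflexive)
open import Data.Product.Base using (_×_; _,_; ∃-syntax)
open import Data.Sum.Base using (inj₁; inj₂)
import Data.Vec.Base as Vec
open import Data.Vec.Properties using (≡-dec)
open import Function.Base using (id)
open import Relation.Binary.PropositionalEquality using (_≡_; _≢_; refl; sym; cong)
open import Relation.Nullary.Decidable using (_×-dec_)
open import Relation.Unary using (Decidable)

-- A family Λ = {A₁, …, Aᵣ} ⊆ I_ℓ[m] is a list of pairwise distinct ℓ-element
-- subsets of [m], with [m] modelled by Fin m; its cardinality is then its
-- length.  Permuting the list affects none of the notions below.

IsFamily : ∀ {m} → ℕ → List (Subset m) → Set
IsFamily ℓ Λ = Unique Λ × All (λ A → ∣ A ∣ ≡ ℓ) Λ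

-- The truncated ℓ ∸ 1 is only meant for 1 ≤ ℓ.

Close : ∀ {m} → ℕ → List (Subset m) → Set
Close ℓ Λ = ∀ {A B} → A ∈ Λ → B ∈ Λ → A ≢ B → ∣ A ∩ B ∣ ≡ ℓ ∸ 1

-- K Λ = Σ_{i<j} |Aᵢ ∩ Aⱼ|, grouped by the smaller index i.

K : ∀ {m} → List (Subset m) → ℕ
K []      = 0
K (A ∷ Λ) = sum (map (λ B → ∣ A ∩ B ∣) Λ) + K Λ

isFamily? : ∀ {m} ℓ → Decidable (IsFamily {m} ℓ)
isFamily? ℓ Λ =
  DecUnique.unique? (≡-dec Bool._≟_) Λ ×-dec All.all? (λ A → ∣ A ∣ ≟ ℓ) Λ

subsets : ∀ m → List (Subset m)
subsets zero    = Vec.[] ∷ []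
subsets (suc m) = cartesianProductWith Vec._∷_ (inside ∷ outside ∷ []) (subsets m)

tuples : ∀ {a} {A : Set a} → ℕ → List A → List (List A)
tuples zero    xs = [] ∷ []
tuples (suc r) xs = cartesianProductWith _∷_ xs (tuples r xs)

-- Every family occurs here once for each ordering of its members.

families : ∀ r ℓ m → List (List (Subset m))
families r ℓ m = filter (isFamily? ℓ) (tuples r (subsets m))

-- K_r(ℓ, m).  The default 0 only determines the value when there is no family
-- of cardinality r, that is, when r exceeds the binomial coefficient m C ℓ; see
-- K≤maxK and maxK-attained.

maxK : ℕ → ℕ → ℕ → ℕ
maxK r ℓ m = max 0 (map K (families r ℓ m))

μ : ℕ → ℕ → ℕ
μ ℓ m = (ℓ ⊔ (m ∸ ℓ)) + 1

∈-sides : ∀ x → x ∈ inside ∷ outside ∷ []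
∈-sides inside  = here refl
∈-sides outside = there (here refl)

∈-subsets : ∀ {m} (A : Subset m) → A ∈ subsets m
∈-subsets Vec.[]      = here refl
∈-subsets (x Vec.∷ A) =
  ∈-cartesianProductWith⁺ Vec._∷_ {xs = inside ∷ outside ∷ []} (∈-sides x) (∈-subsets A)

∈-tuples⁺ : ∀ {m} (Λ : List (Subset m)) → Λ ∈ tuples (length Λ) (subsets m)
∈-tuples⁺ []      = here refl
∈-tuples⁺ (A ∷ Λ) = ∈-cartesianProductWith⁺ _∷_ (∈-subsets A) (∈-tuples⁺ Λ)

∈-tuples⁻ : ∀ {a} {A : Set a} r {xs ys : List A} → ys ∈ tuples r xs → length ys ≡ r
∈-tuples⁻ zero    (here refl) = refl
∈-tuples⁻ (suc r) {xs} ys∈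
  with _ , _ , _ , zs∈ , refl ← ∈-cartesianProductWith⁻ _∷_ xs (tuples r xs) ys∈
  = cong suc (∈-tuples⁻ r zs∈)

∈-families⁺ : ∀ {r ℓ m} {Λ : List (Subset m)} →
              IsFamily ℓ Λ → length Λ ≡ r → Λ ∈ families r ℓ m
∈-families⁺ {ℓ = ℓ} {Λ = Λ} Λ-fam refl = ∈-filter⁺ (isFamily? ℓ) (∈-tuples⁺ Λ) Λ-fam

∈-families⁻ : ∀ {r ℓ m} {Λ : List (Subset m)} →
              Λ ∈ families r ℓ m → IsFamily ℓ Λ × length Λ ≡ r
∈-families⁻ {r} {ℓ} {m} Λ∈
  with Λ∈t , Λ-fam ← ∈-filter⁻ (isFamily? ℓ) {xs = tuples r (subsets m)} Λ∈
  = Λ-fam , ∈-tuples⁻ r Λ∈t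

K≤maxK : ∀ {r ℓ m} {Λ : List (Subset m)} →
         IsFamily ℓ Λ → length Λ ≡ r → K Λ ≤ maxK r ℓ m
K≤maxK {r} {ℓ} {m} Λ-fam |Λ|≡r =
  All.lookup (xs≤max 0 (map K (families r ℓ m))) (∈-map⁺ K (∈-families⁺ Λ-fam |Λ|≡r))

maxK-attained : ∀ {r ℓ m} → ∃[ Λ ] (IsFamily {m} ℓ Λ × length Λ ≡ r) →
                ∃[ Λ ] (IsFamily {m} ℓ Λ × length Λ ≡ r × K Λ ≡ maxK r ℓ m)
maxK-attained {r} {ℓ} {m} (Λ , Λ-fam , |Λ|≡r)
  with argmax-sel id 0 (map K (families r ℓ m))
... | inj₁ max≡0 = Λ , Λ-fam , |Λ|≡r ,
  ≤-antisym (K≤maxK Λ-fam |Λ|≡r) (≤-trans (≤-reflexive max≡0) z≤n)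
... | inj₂ max∈ with Λ′ , Λ′∈ , max≡K ← ∈-map⁻ K {xs = families r ℓ m} max∈
                with Λ′-fam , |Λ′|≡r ← ∈-families⁻ {r} {ℓ} {m} Λ′∈
  = Λ′ , Λ′-fam , |Λ′|≡r , sym max≡K

{-# OPTIONS --safe #-}

-- Distinct ℓ-sets meet in at most ℓ − 1 points, so K Λ is a sum of |Λ| C 2
-- terms each at most ℓ − 1, and it attains the bound exactly when every term does.
--
-- The sets obtained from an (ℓ + 1)-set by removing a point form a close family,
-- and so do those obtained from an (ℓ − 1)-set by adding one; this gives close
-- families of all sizes up to μ.  That no close family is larger follows by
-- induction on m.  Split Λ into the layers Λ₀ and Λ₁ of sets avoiding and
-- containing the first point.  Once that point is dropped, every A ∈ Λ₀ arises
-- from every B ∈ Λ₁ by adding a point, so Λ₀ and Λ₁ cannot both have two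
-- members, and if one of them is a singleton then the other consists of its
-- one-point extensions or one-point deletions.

module Submission where

open import Defs
open import Data.Bool.Base using (not)
open import Data.Bool.Properties using (not-¬) renaming (_≟_ to _≟ᵇ_)
open import Data.Fin.Subset using (Subset; Side; _∩_; ∣_∣; inside; outside)
open import Data.Fin.Subset.Properties
  using (∩-comm; ∩-idem; ∣p∩q∣≤∣p∣; ∣p∩q∣≤∣q∣)
open import Data.List.Base using (List; []; _∷_; _++_; length; map; take)
open import Data.List.Membership.Propositional using (_∈_)
open import Data.List.Membership.Propositional.Properties using (∈-map⁺; ∈-map⁻; ∈-∃++)
open import Data.List.Properties using (length-map; length-++; length-take)
open import Data.List.Relation.Binary.Permutation.Propositional.Properties
  using (∈-resp-↭; shift; ↭-length)
open import Data.List.Relation.Unary.All as All using (All; []; _∷_)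
import Data.List.Relation.Unary.All.Properties as All
open import Data.List.Relation.Unary.AllPairs using (AllPairs; []; _∷_)
open import Data.List.Relation.Unary.Any using (here; there)
open import Data.List.Relation.Unary.Unique.Propositional using (Unique)
import Data.List.Relation.Unary.Unique.Propositional.Properties as Unique
open import Data.Nat.Base
  using (ℕ; zero; suc; pred; _+_; _*_; _∸_; _≤_; _<_; z≤n; s≤s)
open import Data.Nat.Combinatorics using (_C_; nC1≡n; nCk+nC[k+1]≡[n+1]C[k+1]; nCn≡1)
open import Data.Nat.ListAction using (sum)
open import Data.Nat.Properties
open import Data.Product.Base using (_×_; _,_; proj₁; ∃-syntax)
open import Data.Sum.Base using (_⊎_; inj₁; inj₂)
open import Data.Vec.Base using ([]; _∷_; count)
import Data.Vec.Properties as Vec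
open import Function.Base using (_∘_)
open import Function.Bundles using (_⇔_; mk⇔; Equivalence)
open import Level using (Level)
open import Relation.Binary.PropositionalEquality
  using (_≡_; _≢_; refl; sym; trans; cong; cong₂; module ≡-Reasoning)
open import Relation.Nullary using (yes; no; contradiction)

private
  variable
    a : Level
    X : Set a
    c ℓ m r : ℕ
    s x : Side
    A A′ B B′ : Subset m
    Λ : List (Subset m)

-- Sums of bounded terms and their equality case.

+-≤-≡ : ∀ {m n M N} → m ≤ M → n ≤ N → m + n ≡ M + N → m ≡ M × n ≡ N
+-≤-≡ {m} {n} {M} {N} m≤M n≤N eq = m≡M , n≡N
  where
  m≡M : m ≡ M
  m≡M = ≤-antisym m≤M
    (+-cancelʳ-≤ N M m (≤-trans (≤-reflexive (sym eq)) (+-monoʳ-≤ m n≤N)))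

  n≡N : n ≡ N
  n≡N = +-cancelˡ-≡ M n N (trans (cong (_+ n) (sym m≡M)) eq)

module _ (f : X → ℕ) where

  sum-map-≤ : ∀ {xs} → All (λ x → f x ≤ c) xs → sum (map f xs) ≤ c * length xs
  sum-map-≤ []                  = z≤n
  sum-map-≤ {c} {x ∷ xs} (p ∷ ps) rewrite *-suc c (length xs) =
    +-mono-≤ p (sum-map-≤ ps)

  sum-map-≡⁺ : ∀ {xs} → All (λ x → f x ≡ c) xs → sum (map f xs) ≡ c * length xs
  sum-map-≡⁺ {c} []                = sym (*-zeroʳ c)
  sum-map-≡⁺ {c} {x ∷ xs} (p ∷ ps) rewrite *-suc c (length xs) =
    cong₂ _+_ p (sum-map-≡⁺ ps)

  sum-map-≡⁻ : ∀ {xs} → All (λ x → f x ≤ c) xs →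
               sum (map f xs) ≡ c * length xs → All (λ x → f x ≡ c) xs
  sum-map-≡⁻ []       eq = []
  sum-map-≡⁻ {c} {x ∷ xs} (p ∷ ps) eq
    with q , qs ← +-≤-≡ p (sum-map-≤ ps) (trans eq (*-suc c (length xs)))
    = q ∷ sum-map-≡⁻ ps qs

-- Pascal's rule in the shape of the recursion of `K`: a new head adds `n` pairs to the `n C 2`
-- pairs of the tail.
*-[1+n]C2 : ∀ c n → c * (suc n C 2) ≡ c * n + c * (n C 2)
*-[1+n]C2 c n = begin
  c * (suc n C 2)        ≡⟨ cong (c *_) (nCk+nC[k+1]≡[n+1]C[k+1] n 1) ⟨
  c * (n C 1 + n C 2)    ≡⟨ cong (λ k → c * (k + n C 2)) (nC1≡n n) ⟩
  c * (n + n C 2)        ≡⟨ *-distribˡ-+ c n (n C 2) ⟩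
  c * n + c * (n C 2)    ∎
  where open ≡-Reasoning

K-≤ : AllPairs (λ A B → ∣ A ∩ B ∣ ≤ c) Λ → K Λ ≤ c * (length Λ C 2)
K-≤ []                      = z≤n
K-≤ {c} {Λ = A ∷ Λ} (p ∷ ps) rewrite *-[1+n]C2 c (length Λ) =
  +-mono-≤ (sum-map-≤ _ p) (K-≤ ps)

K-≡⁺ : AllPairs (λ A B → ∣ A ∩ B ∣ ≡ c) Λ → K Λ ≡ c * (length Λ C 2)
K-≡⁺ {c} []                  = sym (*-zeroʳ c)
K-≡⁺ {c} {Λ = A ∷ Λ} (p ∷ ps) rewrite *-[1+n]C2 c (length Λ) =
  cong₂ _+_ (sum-map-≡⁺ _ p) (K-≡⁺ ps)

K-≡⁻ : AllPairs (λ A B → ∣ A ∩ B ∣ ≤ c) Λ → K Λ ≡ c * (length Λ C 2) →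
       AllPairs (λ A B → ∣ A ∩ B ∣ ≡ c) Λ
K-≡⁻ []       eq = []
K-≡⁻ {c} {Λ = A ∷ Λ} (p ∷ ps) eq
  with q , qs ← +-≤-≡ (sum-map-≤ _ p) (K-≤ ps) (trans eq (*-[1+n]C2 c (length Λ)))
  = sum-map-≡⁻ _ p q ∷ K-≡⁻ ps qs

-- Intersections of distinct sets of equal size.

-- The first equation says that `B` is contained in `A`, and equal sizes leave no room for a further
-- point.
∣A∩B∣≡∣B∣∧∣A∣≡∣B∣⇒A≡B : (A B : Subset m) → ∣ A ∩ B ∣ ≡ ∣ B ∣ → ∣ A ∣ ≡ ∣ B ∣ → A ≡ B
∣A∩B∣≡∣B∣∧∣A∣≡∣B∣⇒A≡B []            []            p q = refl
∣A∩B∣≡∣B∣∧∣A∣≡∣B∣⇒A≡B (inside  ∷ A) (inside  ∷ B) p q =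
  cong (inside ∷_) (∣A∩B∣≡∣B∣∧∣A∣≡∣B∣⇒A≡B A B (suc-injective p) (suc-injective q))
∣A∩B∣≡∣B∣∧∣A∣≡∣B∣⇒A≡B (inside  ∷ A) (outside ∷ B) p q =
  contradiction (≤-trans (≤-reflexive (trans q (sym p))) (∣p∩q∣≤∣p∣ A B)) 1+n≰n
∣A∩B∣≡∣B∣∧∣A∣≡∣B∣⇒A≡B (outside ∷ A) (inside  ∷ B) p q =
  contradiction (≤-trans (≤-reflexive (sym p)) (∣p∩q∣≤∣q∣ A B)) 1+n≰n
∣A∩B∣≡∣B∣∧∣A∣≡∣B∣⇒A≡B (outside ∷ A) (outside ∷ B) p q =
  cong (outside ∷_) (∣A∩B∣≡∣B∣∧∣A∣≡∣B∣⇒A≡B A B p q)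

∣A∩B∣≤ℓ∸1 : ∣ A ∣ ≡ ℓ → ∣ B ∣ ≡ ℓ → A ≢ B → ∣ A ∩ B ∣ ≤ ℓ ∸ 1
∣A∩B∣≤ℓ∸1 {A = A} {B = B} p refl A≢B = <⇒≤pred
  (≤∧≢⇒< (∣p∩q∣≤∣q∣ A B) λ eq → A≢B (∣A∩B∣≡∣B∣∧∣A∣≡∣B∣⇒A≡B A B eq p))

family⇒∩-≤ : IsFamily ℓ Λ → AllPairs (λ A B → ∣ A ∩ B ∣ ≤ ℓ ∸ 1) Λ
family⇒∩-≤ ([]     , [])     = []
family⇒∩-≤ (≢s ∷ u , p ∷ ps) =
  All.zipWith (λ (A≢B , q) → ∣A∩B∣≤ℓ∸1 p q A≢B) (≢s , ps) ∷ family⇒∩-≤ (u , ps)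

close⇒∩-≡ : ∀ ℓ → Unique Λ → Close ℓ Λ → AllPairs (λ A B → ∣ A ∩ B ∣ ≡ ℓ ∸ 1) Λ
close⇒∩-≡ ℓ []       cl = []
close⇒∩-≡ ℓ (≢s ∷ u) cl =
  All.tabulate (λ B∈ → cl (here refl) (there B∈) (All.lookup ≢s B∈)) ∷
  close⇒∩-≡ ℓ u (λ A∈ B∈ → cl (there A∈) (there B∈))

∩-≡⇒close : ∀ ℓ → AllPairs (λ A B → ∣ A ∩ B ∣ ≡ ℓ ∸ 1) Λ → Close ℓ Λ
∩-≡⇒close ℓ (p ∷ ps) (here refl) (here refl) A≢A = contradiction refl A≢A
∩-≡⇒close ℓ (p ∷ ps) (here refl) (there B∈)  _   = All.lookup p B∈
∩-≡⇒close ℓ (p ∷ ps) {A} {B} (there A∈) (here refl) _ =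
  trans (cong ∣_∣ (∩-comm A B)) (All.lookup p A∈)
∩-≡⇒close ℓ (p ∷ ps) (there A∈)  (there B∈)  A≢B = ∩-≡⇒close ℓ ps A∈ B∈ A≢B

-- Sets that differ in one point.

-- One coordinate changes from `s` to `not s`: for `inside`, `B` is `A` with a point removed; for
-- `outside`, with a point added. Indexing by the side lets both kinds of close family share one
-- enumeration.
data Flip (s : Side) : Subset m → Subset m → Set where
  here  : Flip s (s ∷ A) (not s ∷ A)
  there : Flip s A B → Flip s (x ∷ A) (x ∷ B)

Flip-sym : Flip s A B → Flip (not s) B A
Flip-sym {s = inside}  here      = here
Flip-sym {s = outside} here      = here
Flip-sym               (there f) = there (Flip-sym f)

∩-idem-Flip : Flip inside A B → A ∩ B ≡ B
∩-idem-Flip (here {A = A})          = cong (outside ∷_) (∩-idem A)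
∩-idem-Flip (there {x = inside}  f) = cong (inside ∷_) (∩-idem-Flip f)
∩-idem-Flip (there {x = outside} f) = cong (outside ∷_) (∩-idem-Flip f)

∣Flip-inside∣ : Flip inside A B → ∣ A ∣ ≡ suc ∣ B ∣
∣Flip-inside∣ here                    = refl
∣Flip-inside∣ (there {x = inside}  f) = cong suc (∣Flip-inside∣ f)
∣Flip-inside∣ (there {x = outside} f) = ∣Flip-inside∣ f

-- Here `B` is contained in `A` and has one point fewer. Past the first coordinate where they
-- differ, sizes agree, so the remainders coincide.
∣∩∣⇒Flip-inside : (A B : Subset m) → ∣ A ∩ B ∣ ≡ ∣ B ∣ → ∣ A ∣ ≡ suc ∣ B ∣ → Flip inside A B
∣∩∣⇒Flip-inside (inside  ∷ A) (inside  ∷ B) p q =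
  there (∣∩∣⇒Flip-inside A B (suc-injective p) (suc-injective q))
∣∩∣⇒Flip-inside (inside  ∷ A) (outside ∷ B) p q
  with refl ← ∣A∩B∣≡∣B∣∧∣A∣≡∣B∣⇒A≡B A B p (suc-injective q) = here
∣∩∣⇒Flip-inside (outside ∷ A) (inside  ∷ B) p q =
  contradiction (≤-trans (≤-reflexive (sym p)) (∣p∩q∣≤∣q∣ A B)) 1+n≰n
∣∩∣⇒Flip-inside (outside ∷ A) (outside ∷ B) p q = there (∣∩∣⇒Flip-inside A B p q)

-- As `B` and `B′` differ, the points removed from `A` differ, so the intersection lacks exactly
-- these two.
Flip-inside-∩ : Flip inside A B → Flip inside A B′ → B ≢ B′ → ∣ A ∣ ≡ 2 + ∣ B ∩ B′ ∣
Flip-inside-∩ here      here      B≢B′ = contradiction refl B≢B′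
Flip-inside-∩ here      (there g) _    =
  cong suc (trans (∣Flip-inside∣ g) (cong (suc ∘ ∣_∣) (sym (∩-idem-Flip g))))
Flip-inside-∩ (there {A = A} {B = B} f) here _ = cong suc (trans (∣Flip-inside∣ f)
  (cong (suc ∘ ∣_∣) (sym (trans (∩-comm B A) (∩-idem-Flip f)))))
Flip-inside-∩ (there {x = inside}  f) (there g) B≢B′ =
  cong suc (Flip-inside-∩ f g (B≢B′ ∘ cong _))
Flip-inside-∩ (there {x = outside} f) (there g) B≢B′ = Flip-inside-∩ f g (B≢B′ ∘ cong _)

-- The two added points are distinct, so neither lies in both sets.
Flip-outside-∩ : Flip outside A B → Flip outside A B′ → B ≢ B′ → B ∩ B′ ≡ A
Flip-outside-∩ here      here      B≢B′ = contradiction refl B≢B′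
Flip-outside-∩ (here {A = A}) (there {B = B′} g) _ =
  cong (outside ∷_) (trans (∩-comm A B′) (∩-idem-Flip (Flip-sym g)))
Flip-outside-∩ (there f) here      _    = cong (outside ∷_) (∩-idem-Flip (Flip-sym f))
Flip-outside-∩ (there {x = inside}  f) (there g) B≢B′ =
  cong (inside ∷_) (Flip-outside-∩ f g (B≢B′ ∘ cong _))
Flip-outside-∩ (there {x = outside} f) (there g) B≢B′ =
  cong (outside ∷_) (Flip-outside-∩ f g (B≢B′ ∘ cong _))

-- There is no 4-cycle between two consecutive levels of the Boolean lattice.
Flip-no-4-cycle : Flip inside A B → Flip inside A B′ → Flip inside A′ B → Flip inside A′ B′ →
                  A ≡ A′ ⊎ B ≡ B′
Flip-no-4-cycle here      here      _         _         = inj₂ refl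
Flip-no-4-cycle here      (there g) here      _         = inj₁ refl
Flip-no-4-cycle here      (there g) (there h) ()
Flip-no-4-cycle (there f) here      _         here      = inj₁ refl
Flip-no-4-cycle (there f) here      ()        (there k)
Flip-no-4-cycle (there f) (there g) here      here      = inj₂ refl
Flip-no-4-cycle (there f) (there g) (there h) (there k)
  with Flip-no-4-cycle f g h k
... | inj₁ refl = inj₁ refl
... | inj₂ refl = inj₂ refl

-- Listing and counting the one-point changes of a set.

flips : Side → Subset m → List (Subset m)
flips s []      = []
flips s (x ∷ A) with x ≟ᵇ s
... | yes _ = (not s ∷ A) ∷ map (x ∷_) (flips s A)
... | no  _ = map (x ∷_) (flips s A)

length-flips : ∀ s (A : Subset m) → length (flips s A) ≡ count (_≟ᵇ s) A
length-flips s []      = refl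
length-flips s (x ∷ A) with x ≟ᵇ s
... | yes _ = cong suc (trans (length-map _ (flips s A)) (length-flips s A))
... | no  _ = trans (length-map _ (flips s A)) (length-flips s A)

∈-flips⁺ : Flip s A B → B ∈ flips s A
∈-flips⁺ {s = s} here with s ≟ᵇ s
... | yes _  = here refl
... | no s≢s = contradiction refl s≢s
∈-flips⁺ {s = s} (there {x = x} f) with x ≟ᵇ s
... | yes _ = there (∈-map⁺ _ (∈-flips⁺ f))
... | no  _ = ∈-map⁺ _ (∈-flips⁺ f)

flips-All : ∀ s (A : Subset m) → All (Flip s A) (flips s A)
flips-All s []      = []
flips-All s (x ∷ A) with x ≟ᵇ s
... | yes refl = here ∷ All.map⁺ (All.map there (flips-All s A))
... | no  _    = All.map⁺ (All.map there (flips-All s A))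

flips-Unique : ∀ s (A : Subset m) → Unique (flips s A)
flips-Unique s []      = []
flips-Unique s (x ∷ A) with x ≟ᵇ s
... | yes refl = All.map⁺ (All.tabulate λ _ eq → not-¬ refl (sym (Vec.∷-injectiveˡ eq)))
                 ∷ Unique.map⁺ Vec.∷-injectiveʳ (flips-Unique s A)
... | no  _    = Unique.map⁺ Vec.∷-injectiveʳ (flips-Unique s A)

count-outside : (A : Subset m) → count (_≟ᵇ outside) A + ∣ A ∣ ≡ m
count-outside []            = refl
count-outside (inside  ∷ A) = trans (+-suc _ _) (cong suc (count-outside A))
count-outside (outside ∷ A) = cong suc (count-outside A)

count-outside-∸ : (A : Subset m) → count (_≟ᵇ outside) A ≡ m ∸ ∣ A ∣
count-outside-∸ A = trans (sym (m+n∸n≡m _ ∣ A ∣)) (cong (_∸ ∣ A ∣) (count-outside A))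

-- Delete one occurrence of the head from `ys`: the other members of `xs` differ from it, so they
-- survive and induction applies.
unique-⊆⇒length-≤ : {xs ys : List X} → Unique xs → (∀ {x} → x ∈ xs → x ∈ ys) →
                    length xs ≤ length ys
unique-⊆⇒length-≤ []      _  = z≤n
unique-⊆⇒length-≤ {xs = x ∷ xs} (≢s ∷ u) ⊆ys
  with as , bs , refl ← ∈-∃++ (⊆ys (here refl))
  = ≤-trans (s≤s (unique-⊆⇒length-≤ u rest)) (≤-reflexive (sym (↭-length (shift x as bs))))
  where
  rest : ∀ {y} → y ∈ xs → y ∈ as ++ bs
  rest y∈ with ∈-resp-↭ (shift x as bs) (⊆ys (there y∈))
  ... | here refl = contradiction refl (All.lookup ≢s y∈)
  ... | there y∈′ = y∈′

flips-length-≤ : Unique Λ → (∀ {B} → B ∈ Λ → Flip s A B) → length Λ ≤ count (_≟ᵇ s) A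
flips-length-≤ {s = s} {A = A} u fl =
  ≤-trans (unique-⊆⇒length-≤ u (∈-flips⁺ ∘ fl)) (≤-reflexive (length-flips s A))

-- Upper bound on close families, by layers.

tails : Side → List (Subset (suc m)) → List (Subset m)
tails s []            = []
tails s ((x ∷ A) ∷ Λ) with x ≟ᵇ s
... | yes _ = A ∷ tails s Λ
... | no  _ = tails s Λ

∈-tails⁻ : ∀ s (Λ : List (Subset (suc m))) → A ∈ tails s Λ → s ∷ A ∈ Λ
∈-tails⁻ s ((x ∷ B) ∷ Λ) A∈ with x ≟ᵇ s
∈-tails⁻ s ((x ∷ B) ∷ Λ) (here refl) | yes refl = here refl
∈-tails⁻ s ((x ∷ B) ∷ Λ) (there A∈)  | yes refl = there (∈-tails⁻ s Λ A∈)
∈-tails⁻ s ((x ∷ B) ∷ Λ) A∈          | no _     = there (∈-tails⁻ s Λ A∈)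

tails-Unique : ∀ s {Λ : List (Subset (suc m))} → Unique Λ → Unique (tails s Λ)
tails-Unique s []                          = []
tails-Unique s {(x ∷ A) ∷ Λ} (≢s ∷ u) with x ≟ᵇ s
... | yes refl =
  All.tabulate (λ B∈ → All.lookup ≢s (∈-tails⁻ s Λ B∈) ∘ cong (s ∷_)) ∷ tails-Unique s u
... | no _     = tails-Unique s u

length-tails : (Λ : List (Subset (suc m))) →
               length Λ ≡ length (tails outside Λ) + length (tails inside Λ)
length-tails []                  = refl
length-tails ((inside  ∷ _) ∷ Λ) = trans (cong suc (length-tails Λ)) (sym (+-suc _ _))
length-tails ((outside ∷ _) ∷ Λ) = cong suc (length-tails Λ)

-- Truncation makes this strict at `n = 0`, a case that the induction on layers can reach.
m∸[n∸1]≤[1+m]∸n : ∀ m n → m ∸ (n ∸ 1) ≤ suc m ∸ n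
m∸[n∸1]≤[1+m]∸n m zero    = n≤1+n m
m∸[n∸1]≤[1+m]∸n m (suc n) = ≤-refl

-- If a layer is empty, the bound on the other suffices by monotonicity of `μ`. If `Λ₀` or `Λ₁` is a
-- singleton, its member accounts for the `+ 1` in `μ`, and the other layer has at most `ℓ` or
-- `suc m ∸ ℓ` members respectively.
layers-length-≤ : (Λ₀ Λ₁ : List (Subset m)) → IsFamily ℓ Λ₀ → IsFamily (ℓ ∸ 1) Λ₁ →
                  (∀ {A B} → A ∈ Λ₀ → B ∈ Λ₁ → Flip inside A B) →
                  length Λ₀ ≤ μ ℓ m → length Λ₁ ≤ μ (ℓ ∸ 1) m →
                  length Λ₀ + length Λ₁ ≤ μ ℓ (suc m)
layers-length-≤ {m} {ℓ} [] Λ₁ _ _ _ _ ≤μ₁ = ≤-trans ≤μ₁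
  (+-monoˡ-≤ 1 (⊔-mono-≤ (m∸n≤m ℓ 1) (m∸[n∸1]≤[1+m]∸n m ℓ)))
layers-length-≤ {m} {ℓ} Λ₀@(_ ∷ _) [] _ _ _ ≤μ₀ _ rewrite +-identityʳ (length Λ₀) =
  ≤-trans ≤μ₀ (+-monoˡ-≤ 1 (⊔-monoʳ-≤ ℓ (∸-monoˡ-≤ ℓ (n≤1+n m))))
layers-length-≤ {m} {ℓ} (A ∷ []) Λ₁@(_ ∷ _) (_ , refl ∷ []) (u₁ , _) fl _ _
  rewrite +-comm 1 (length Λ₁) =
  +-monoˡ-≤ 1 (≤-trans (flips-length-≤ u₁ (fl (here refl))) (m≤m⊔n ℓ (suc m ∸ ℓ)))
layers-length-≤ {m} {ℓ} Λ₀@(_ ∷ _ ∷ _) (B ∷ []) (u₀ , _) (_ , ∣B∣ ∷ []) fl _ _ =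
  +-monoˡ-≤ 1 (begin
    length Λ₀                      ≤⟨ flips-length-≤ u₀ (λ A∈ → Flip-sym (fl A∈ (here refl))) ⟩
    count (_≟ᵇ outside) B          ≡⟨ count-outside-∸ B ⟩
    m ∸ ∣ B ∣                      ≡⟨ cong (m ∸_) ∣B∣ ⟩
    m ∸ (ℓ ∸ 1)                    ≤⟨ m∸[n∸1]≤[1+m]∸n m ℓ ⟩
    suc m ∸ ℓ                      ≤⟨ m≤n⊔m ℓ (suc m ∸ ℓ) ⟩
    _                              ∎)
  where open ≤-Reasoning
layers-length-≤ (A ∷ A′ ∷ _) (B ∷ B′ ∷ _) (((A≢A′ ∷ _) ∷ _) , _) (((B≢B′ ∷ _) ∷ _) , _) fl _ _
  with Flip-no-4-cycle (fl (here refl) (here refl))         (fl (here refl) (there (here refl)))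
                       (fl (there (here refl)) (here refl)) (fl (there (here refl)) (there (here refl)))
... | inj₁ A≡A′ = contradiction A≡A′ A≢A′
... | inj₂ B≡B′ = contradiction B≡B′ B≢B′

-- The induction on `m` keeps `ℓ` general, because the layer containing the first point becomes a
-- close family of sets of size `ℓ ∸ 1`.
close⇒length-≤-μ : ∀ ℓ m {Λ : List (Subset m)} → IsFamily ℓ Λ → Close ℓ Λ → length Λ ≤ μ ℓ m
close⇒length-≤-μ ℓ zero {[]}              _ _ = z≤n
close⇒length-≤-μ ℓ zero {_ ∷ []}          _ _ = m≤n+m 1 _
close⇒length-≤-μ ℓ zero {[] ∷ [] ∷ _} ((([]≢[] ∷ _) ∷ _) , _) _ = contradiction refl []≢[]
close⇒length-≤-μ ℓ (suc m) {Λ} (u , sizes) cl = begin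
  length Λ              ≡⟨ length-tails Λ ⟩
  length Λ₀ + length Λ₁ ≤⟨ layers-length-≤ Λ₀ Λ₁ fam₀ fam₁ cross
                             (close⇒length-≤-μ ℓ m fam₀ close₀)
                             (close⇒length-≤-μ (ℓ ∸ 1) m fam₁ close₁) ⟩
  μ ℓ (suc m)           ∎
  where
  open ≤-Reasoning

  Λ₀ = tails outside Λ
  Λ₁ = tails inside Λ

  size₀ : ∀ {A} → A ∈ Λ₀ → ∣ A ∣ ≡ ℓ
  size₀ A∈ = All.lookup sizes (∈-tails⁻ outside Λ A∈)

  size₁ : ∀ {B} → B ∈ Λ₁ → suc ∣ B ∣ ≡ ℓ
  size₁ B∈ = All.lookup sizes (∈-tails⁻ inside Λ B∈)

  fam₀ : IsFamily ℓ Λ₀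
  fam₀ = tails-Unique outside u , All.tabulate size₀

  fam₁ : IsFamily (ℓ ∸ 1) Λ₁
  fam₁ = tails-Unique inside u , All.tabulate (cong pred ∘ size₁)

  close₀ : Close ℓ Λ₀
  close₀ A∈ B∈ A≢B =
    cl (∈-tails⁻ outside Λ A∈) (∈-tails⁻ outside Λ B∈) (A≢B ∘ Vec.∷-injectiveʳ)

  close₁ : Close (ℓ ∸ 1) Λ₁
  close₁ A∈ B∈ A≢B =
    cong pred (cl (∈-tails⁻ inside Λ A∈) (∈-tails⁻ inside Λ B∈) (A≢B ∘ Vec.∷-injectiveʳ))

  cross : ∀ {A B} → A ∈ Λ₀ → B ∈ Λ₁ → Flip inside A B
  -- The first point lies in only one of the two original sets, so closeness gives `A ∩ B` size
  -- `ℓ ∸ 1`, which is the size of `B`.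
  cross {A} {B} A∈ B∈ = ∣∩∣⇒Flip-inside A B
    (trans (cl (∈-tails⁻ outside Λ A∈) (∈-tails⁻ inside Λ B∈) λ ())
           (cong pred (sym (size₁ B∈))))
    (trans (size₀ A∈) (sym (size₁ B∈)))

-- Families and close families of prescribed size.

subset-of-size : ∀ {n m} → n ≤ m → ∃[ A ] ∣_∣ {m} A ≡ n
subset-of-size {m = zero}  z≤n       = [] , refl
subset-of-size {m = suc m} z≤n       with A , p ← subset-of-size {m = m} z≤n = outside ∷ A , p
subset-of-size             (s≤s n≤m) with A , p ← subset-of-size n≤m         = inside  ∷ A , cong suc p

-- All `ℓ`-sets, generated along Pascal's rule so that the length is visibly a binomial coefficient.
layer : (ℓ m : ℕ) → List (Subset m)
layer zero    zero    = [] ∷ []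
layer (suc ℓ) zero    = []
layer zero    (suc m) = map (outside ∷_) (layer zero m)
layer (suc ℓ) (suc m) = map (inside ∷_) (layer ℓ m) ++ map (outside ∷_) (layer (suc ℓ) m)

length-layer : (ℓ m : ℕ) → length (layer ℓ m) ≡ m C ℓ
length-layer zero    zero    = refl
length-layer (suc ℓ) zero    = refl
length-layer zero    (suc m) = trans (length-map _ (layer zero m)) (length-layer zero m)
length-layer (suc ℓ) (suc m) = begin
  length (map (inside ∷_) (layer ℓ m) ++ map (outside ∷_) (layer (suc ℓ) m))
    ≡⟨ length-++ (map (inside ∷_) (layer ℓ m)) ⟩
  length (map (inside ∷_) (layer ℓ m)) + length (map (outside ∷_) (layer (suc ℓ) m))
    ≡⟨ cong₂ _+_ (trans (length-map _ (layer ℓ m)) (length-layer ℓ m))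
                 (trans (length-map _ (layer (suc ℓ) m)) (length-layer (suc ℓ) m)) ⟩
  m C ℓ + m C suc ℓ
    ≡⟨ nCk+nC[k+1]≡[n+1]C[k+1] m ℓ ⟩
  suc m C suc ℓ ∎
  where open ≡-Reasoning

layer-family : ∀ ℓ m → IsFamily ℓ (layer ℓ m)
layer-family zero    zero    = [] ∷ [] , refl ∷ []
layer-family (suc ℓ) zero    = [] , []
layer-family zero    (suc m) with u , p ← layer-family zero m =
  Unique.map⁺ Vec.∷-injectiveʳ u , All.map⁺ p
layer-family (suc ℓ) (suc m)
  with u , p ← layer-family ℓ m | v , q ← layer-family (suc ℓ) m =
  Unique.++⁺ (Unique.map⁺ Vec.∷-injectiveʳ u) (Unique.map⁺ Vec.∷-injectiveʳ v) disjoint ,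
  All.++⁺ (All.map⁺ (All.map (cong suc) p)) (All.map⁺ q)
  where
  disjoint : ∀ {A} → A ∈ map (inside ∷_) (layer ℓ m) × A ∈ map (outside ∷_) (layer (suc ℓ) m) → _
  disjoint (A∈ , A∈′) with _ , _ , refl ← ∈-map⁻ (inside ∷_) A∈ | _ , _ , () ← ∈-map⁻ (outside ∷_) A∈′

length-take-≤ : {xs : List X} → r ≤ length xs → length (take r xs) ≡ r
length-take-≤ {r = r} {xs} r≤ = trans (length-take r xs) (m≤n⇒m⊓n≡m r≤)

-- This provides the family that `maxK-attained` asks for, so `maxK` is a genuine maximum in this
-- range.
∃-family : r ≤ m C ℓ → ∃[ Λ ] (IsFamily {m} ℓ Λ × length Λ ≡ r)
∃-family {r} {m} {ℓ} r≤ with u , p ← layer-family ℓ m =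
  take r (layer ℓ m) , (Unique.take⁺ r u , All.take⁺ r p) ,
  length-take-≤ (≤-trans r≤ (≤-reflexive (sym (length-layer ℓ m))))

∃-flips-family : ∀ s (A : Subset m) → r ≤ count (_≟ᵇ s) A →
                 (∀ {B} → Flip s A B → ∣ B ∣ ≡ ℓ) →
                 (∀ {B B′} → Flip s A B → Flip s A B′ → B ≢ B′ → ∣ B ∩ B′ ∣ ≡ ℓ ∸ 1) →
                 ∃[ Λ ] (IsFamily {m} ℓ Λ × length Λ ≡ r × Close ℓ Λ)
∃-flips-family {r = r} s A r≤ size inter =
  take r (flips s A) ,
  (Unique.take⁺ r (flips-Unique s A) , All.map size fl) ,
  length-take-≤ (≤-trans r≤ (≤-reflexive (sym (length-flips s A)))) ,
  λ B∈ B′∈ → inter (All.lookup fl B∈) (All.lookup fl B′∈)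
  where
  fl = All.take⁺ r (flips-All s A)

∃-close-inside : ℓ < m → r ≤ suc ℓ → ∃[ Λ ] (IsFamily {m} ℓ Λ × length Λ ≡ r × Close ℓ Λ)
∃-close-inside ℓ<m r≤ with A , ∣A∣ ← subset-of-size ℓ<m =
  ∃-flips-family inside A (≤-trans r≤ (≤-reflexive (sym ∣A∣)))
    (λ f → suc-injective (trans (sym (∣Flip-inside∣ f)) ∣A∣))
    -- From `suc ℓ ≡ 2 + ∣ B ∩ B′ ∣`, subtracting 2 gives `ℓ ∸ 1`.
    (λ f g B≢B′ → sym (cong (_∸ 2) (trans (sym ∣A∣) (Flip-inside-∩ f g B≢B′))))

∃-close-outside : 1 ≤ ℓ → ℓ ≤ m → r ≤ suc (m ∸ ℓ) →
                  ∃[ Λ ] (IsFamily {m} ℓ Λ × length Λ ≡ r × Close ℓ Λ)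
∃-close-outside {suc ℓ} {suc m} _ (s≤s ℓ≤m) r≤
  -- `A` has one point fewer than the sets sought, so one more point lies outside it than outside
  -- each of them.
  with A , refl ← subset-of-size (m≤n⇒m≤1+n ℓ≤m) =
  ∃-flips-family outside A
    (≤-trans r≤ (≤-reflexive (trans (sym (+-∸-assoc 1 ℓ≤m)) (sym (count-outside-∸ A)))))
    (λ f → ∣Flip-inside∣ (Flip-sym f))
    (λ f g B≢B′ → cong ∣_∣ (Flip-outside-∩ f g B≢B′))

-- Adding points serves every `r` up to `suc (m ∸ ℓ)`. For larger `r`, the maximum in `μ` must be
-- `ℓ`, and removing points serves.
∃-close : 1 ≤ ℓ → ℓ ≤ m → r ≤ m C ℓ → r ≤ μ ℓ m →
          ∃[ Λ ] (IsFamily {m} ℓ Λ × length Λ ≡ r × Close ℓ Λ)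
∃-close {ℓ} {m} {r} 1≤ℓ ℓ≤m r≤C r≤μ with r ≤? suc (m ∸ ℓ)
... | yes r≤ = ∃-close-outside 1≤ℓ ℓ≤m r≤
... | no r≰  = ∃-close-inside ℓ<m r≤ℓ+1
  where
  r≤ℓ+1 : r ≤ suc ℓ
  r≤ℓ+1 with ≤-total ℓ (m ∸ ℓ)
  ... | inj₁ ℓ≤ = contradiction
    (≤-trans r≤μ (≤-reflexive (trans (+-comm _ 1) (cong suc (m≤n⇒m⊔n≡n ℓ≤))))) r≰
  ... | inj₂ ≥ℓ = ≤-trans r≤μ (≤-reflexive (trans (+-comm _ 1) (cong suc (m≥n⇒m⊔n≡m ≥ℓ))))

  ℓ<m : ℓ < m
  -- If `ℓ = m`, there is only one `ℓ`-set, so `r` is at most 1 and already falls under the other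
  -- case.
  ℓ<m = ≤∧≢⇒< ℓ≤m λ { refl → r≰ (≤-trans r≤C (≤-trans (≤-reflexive (nCn≡1 m)) (s≤s z≤n))) }

-- The two bounds and their equality cases.

K-bound : IsFamily ℓ Λ → K Λ ≤ (ℓ ∸ 1) * (length Λ C 2)
K-bound = K-≤ ∘ family⇒∩-≤

K-bound-≡⇔close : IsFamily ℓ Λ → K Λ ≡ (ℓ ∸ 1) * (length Λ C 2) ⇔ Close ℓ Λ
K-bound-≡⇔close {ℓ} {Λ = Λ} fam = mk⇔ to from
  where
  to : K Λ ≡ (ℓ ∸ 1) * (length Λ C 2) → Close ℓ Λ
  to eq = ∩-≡⇒close ℓ (K-≡⁻ (family⇒∩-≤ fam) eq)

  from : Close ℓ Λ → K Λ ≡ (ℓ ∸ 1) * (length Λ C 2)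
  from cl = K-≡⁺ (close⇒∩-≡ ℓ (proj₁ fam) cl)

proposition4 : ∀ (ℓ m : ℕ) → 1 ≤ ℓ → ℓ ≤ m →
    (∀ (Λ : List (Subset m)) → IsFamily ℓ Λ →
    K Λ ≤ (ℓ ∸ 1) * (length Λ C 2)
    × (K Λ ≡ (ℓ ∸ 1) * (length Λ C 2) ⇔ Close ℓ Λ))
    × (∀ (r : ℕ) → r ≤ m C ℓ →
    maxK r ℓ m ≤ (ℓ ∸ 1) * (r C 2)
    × (maxK r ℓ m ≡ (ℓ ∸ 1) * (r C 2) ⇔ r ≤ μ ℓ m))
proposition4 ℓ m 1≤ℓ ℓ≤m = (λ Λ fam → K-bound fam , K-bound-≡⇔close fam) , maxK-bound
  where
  maxK-bound : ∀ r → r ≤ m C ℓ →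
               maxK r ℓ m ≤ (ℓ ∸ 1) * (r C 2) ×
               (maxK r ℓ m ≡ (ℓ ∸ 1) * (r C 2) ⇔ r ≤ μ ℓ m)
  maxK-bound r r≤C
    -- `Λ` is a family attaining the maximum; the bound and the forward direction are read off from
    -- it.
    with Λ , fam , refl , K≡ ← maxK-attained {r} {ℓ} {m} (∃-family r≤C)
    = bound , mk⇔ to from
    where
    bound : maxK r ℓ m ≤ (ℓ ∸ 1) * (r C 2)
    bound = ≤-trans (≤-reflexive (sym K≡)) (K-bound fam)

    to : maxK r ℓ m ≡ (ℓ ∸ 1) * (r C 2) → r ≤ μ ℓ m
    to eq = close⇒length-≤-μ ℓ m fam (Equivalence.to (K-bound-≡⇔close fam) (trans K≡ eq))

    from : r ≤ μ ℓ m → maxK r ℓ m ≡ (ℓ ∸ 1) * (r C 2)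
    -- A close family `Λ′` of `r` sets attains the bound, so the maximum cannot be smaller.
    from r≤μ with Λ′ , fam′ , |Λ′|≡r , cl ← ∃-close 1≤ℓ ℓ≤m r≤C r≤μ =
      ≤-antisym bound (≤-trans (≤-reflexive (trans (cong (λ n → (ℓ ∸ 1) * (n C 2)) (sym |Λ′|≡r))
        (sym (Equivalence.from (K-bound-≡⇔close fam′) cl)))) (K≤maxK fam′ |Λ′|≡r))
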